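{- Let $G$ be a finite simple undirected $2$-connected graph with degree sequence $d_1\le d_2\le\ldots\le d_n$ and minimum degree $\delta=d_1$. Let $c$ be the order of a longest cycle in $G$ and $p$ the order of a longest path in $G$. Then $c\ge\min\{p,\,d_\delta+d_{\delta+1}\}$.
   Context: Graphs are finite and undirected, with neither loops nor multiple edges. The number of vertices of $G$ is $n$. A graph is $2$-connected if its vertex connectivity is at least $2$ (in particular it has at least $3$ vertices). The degree sequence $d_1\le d_2\le\ldots\le d_n$ lists the degrees of all $n$ vertices of $G$ in nondecreasing order, indexed from $1$; its first term $d_1$ is the minimum degree of $G$, denoted $\delta$. Thus $d_\delta$ and $d_{\delta+1}$ are the $\delta$-th and $(\delta+1)$-th terms of this sequence. The order of a cycle or path is its number of vertices. -}

module Defs where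

open import Data.Empty using (⊥-elim)
open import Data.Fin.Base using (Fin; zero; suc)
open import Data.Fin.Subset using (Subset; ∣_∣; _∉_) renaming (⊥ to ∅)
open import Data.Fin.Subset.Properties using (∣⊥∣≡0; ∉⊥)
open import Data.List.Base using (List; []; _∷_; _++_; length; map; filter; allFin)
open import Data.List.Membership.Propositional using (_∈_; lose)
open import Data.List.Membership.Propositional.Properties
  using (∈-allFin; ∈-map⁻; ∈-filter⁺; ∈-length)
open import Data.List.NonEmpty as List⁺ using (List⁺; _∷_)
open import Data.List.Properties using (length-map; length-tabulate; filter-notAll)
open import Data.List.Relation.Binary.Permutation.Propositional.Properties
  using (∈-resp-↭; ↭-length)
open import Data.List.Relation.Unary.Any using (here)
open import Data.List.Relation.Unary.Linked using (Linked)
open import Data.List.Relation.Unary.Unique.Propositional using (Unique)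
open import Data.List.Sort using (sort; sort-↭)
open import Data.Nat.Base using (ℕ; zero; suc; _≤_; _<_; s≤s; z≤n)
open import Data.Nat.Properties using (≤-decTotalOrder; ≤-trans; ≤-<-trans)
open import Data.Product.Base using (∃; _×_; _,_; proj₁; proj₂)
open import Relation.Binary.Construct.Closure.ReflexiveTransitive using (Star; ε; _◅_)
open import Relation.Binary.Definitions using (Decidable; Symmetric; Irreflexive)
open import Relation.Binary.PropositionalEquality
  using (_≡_; _≢_; refl; sym; trans; subst)

-- Adjacency is decidable so that neighbours can be counted.
record Graph (n : ℕ) : Set₁ where
  field
    Adj    : Fin n → Fin n → Set
    adj?   : Decidable Adj
    symm   : Symmetric Adj
    irrefl : Irreflexive _≡_ Adj

module _ {n : ℕ} (G : Graph n) where
  open Graph G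

  degree : Fin n → ℕ
  degree v = length (filter (adj? v) (allFin n))

  degreeSequence : List ℕ
  degreeSequence = sort ≤-decTotalOrder (map degree (allFin n))

  -- Adjacency in G − S; every vertex outside S is a vertex of G − S.
  AdjOutside : Subset n → Fin n → Fin n → Set
  AdjOutside S u v = u ∉ S × v ∉ S × Adj u v

  ConnectedOutside : Subset n → Set
  ConnectedOutside S = ∀ u v → u ∉ S → v ∉ S → Star (AdjOutside S) u v

  Connected[_] : ℕ → Set
  Connected[ k ] = k < n × (∀ S → ∣ S ∣ < k → ConnectedOutside S)

  -- The greatest k for which G is k-connected; in particular κ(Kₙ) = n − 1.
  IsVertexConnectivity : ℕ → Set
  IsVertexConnectivity κ = Connected[ κ ] × (∀ k → Connected[ k ] → k ≤ κ)

  TwoConnected : Set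
  TwoConnected = ∃ λ κ → IsVertexConnectivity κ × 2 ≤ κ

  IsPath : List⁺ (Fin n) → Set
  IsPath (x ∷ xs) = Unique (x ∷ xs) × Linked Adj (x ∷ xs)

  -- The first vertex is not repeated in the list representing a cycle.
  IsCycle : List⁺ (Fin n) → Set
  IsCycle (x ∷ xs) =
    3 ≤ length (x ∷ xs) × Unique (x ∷ xs) × Linked Adj (x ∷ xs ++ x ∷ [])

  IsLargestOrder : (List⁺ (Fin n) → Set) → ℕ → Set
  IsLargestOrder P m =
    (∃ λ xs → P xs × List⁺.length xs ≡ m) × (∀ xs → P xs → List⁺.length xs ≤ m)

  IsLongestPathOrder : ℕ → Set
  IsLongestPathOrder = IsLargestOrder IsPath

  IsLongestCycleOrder : ℕ → Set
  IsLongestCycleOrder = IsLargestOrder IsCycle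

-- The i-th term, counting from 1, with junk value 0 when i is out of range.
term : List ℕ → ℕ → ℕ
term []       _             = 0
term (_ ∷ _)  zero          = 0
term (x ∷ _)  (suc zero)    = x
term (_ ∷ xs) (suc (suc i)) = term xs (suc i)

d : ∀ {n} → Graph n → ℕ → ℕ
d G i = term (degreeSequence G) i

δ : ∀ {n} → Graph n → ℕ
δ G = d G 1

-- For a 2-connected graph the indices δ and δ + 1 are in range, so that
-- d G (δ G) and d G (suc (δ G)) never take the junk value of term.

length-degreeSequence : ∀ {n} (G : Graph n) → length (degreeSequence G) ≡ n
length-degreeSequence {n} G =
  trans (↭-length (sort-↭ ≤-decTotalOrder (map (degree G) (allFin n))))
    (trans (length-map (degree G) (allFin n)) (length-tabulate {n = n} (λ i → i)))

private
  term₁-∈ : ∀ xs → 0 < length xs → term xs 1 ∈ xs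
  term₁-∈ (x ∷ xs) _ = here refl

  other : ∀ {n} → 2 < n → (v : Fin n) → ∃ λ u → v ≢ u
  other (s≤s (s≤s _)) zero    = suc zero , λ ()
  other (s≤s (s≤s _)) (suc v) = zero , λ ()

  δ-attained : ∀ {n} (G : Graph n) → 0 < n → ∃ λ v → δ G ≡ degree G v
  δ-attained {n} G 0<n
    with v , _ , eq ← ∈-map⁻ (degree G)
           (∈-resp-↭ (sort-↭ ≤-decTotalOrder (map (degree G) (allFin n)))
             (term₁-∈ (degreeSequence G)
               (subst (0 <_) (sym (length-degreeSequence G)) 0<n)))
    = v , eq

  degree<n : ∀ {n} (G : Graph n) v → degree G v < n
  degree<n {n} G v = subst (degree G v <_) (length-tabulate {n = n} (λ i → i))
    (filter-notAll (adj? v) (allFin n) (lose (∈-allFin v) (irrefl refl)))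
    where open Graph G

  0<degree : ∀ {n} (G : Graph n) {u v} →
             v ≢ u → Star (AdjOutside G ∅) v u → 0 < degree G v
  0<degree G v≢u ε = ⊥-elim (v≢u refl)
  0<degree G {v = v} _ ((_ , _ , a) ◅ _) =
    ∈-length (∈-filter⁺ (Graph.adj? G v) (∈-allFin _) a)

δ-in-range : ∀ {n} (G : Graph n) → TwoConnected G → 1 ≤ δ G × suc (δ G) ≤ n
δ-in-range {n} G (κ , ((κ<n , conn) , _) , 2≤κ)
  with 2<n ← ≤-<-trans 2≤κ κ<n
  with v , eq ← δ-attained G (≤-trans (s≤s z≤n) 2<n)
  with u , v≢u ← other 2<n v
  rewrite eq
  = 0<degree G v≢u
      (conn ∅ (subst (_< κ) (sym (∣⊥∣≡0 n)) (≤-trans (s≤s z≤n) 2≤κ)) v u ∉⊥ ∉⊥)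
  , degree<n G v

-- Among the longest paths take one, from x to y, whose end degrees cannot be increased by
-- replacing an end: if v is a neighbour of x, then going back from the predecessor of v to x
-- and jumping to v is again a longest path. So the deg x predecessors of neighbours of x have
-- degree at most deg x, and likewise at y; when deg y ≤ deg x, the vertex y is one more such
-- vertex at x, whence deg x + deg y ≥ d_δ + d_{δ+1}.
--
-- It remains to find a cycle through all of the path or of order at least deg x + deg y.  If
-- some neighbour of y precedes some neighbour of x on the path, a closest such pair closes up
-- to a cycle that misses no neighbour of x or y, and counting along it suffices.  Otherwise
-- let s be the last neighbour of x and t the first one of y.  Sweeping from s to t,
-- 2-connectedness yields two disjoint paths from the part up to s to the part from t on, one
-- of them ending in s and one in t.  Rerouting inside both parts, they close up to a cycle
-- through x, y and all their neighbours.
module Submission where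

open import Defs
open import Data.Fin.Base using (Fin)
open import Data.Fin.Properties using (_≟_)
open import Data.Fin.Subset using (⁅_⁆)
open import Data.Fin.Subset.Properties using (∣⁅x⁆∣≡1; x≢y⇒x∉⁅y⁆; x∉⁅y⁆⇒x≢y)
open import Data.List.Base using (List; []; _∷_; [_]; _++_; _∷ʳ_; length; map; filter; allFin)
open import Data.List.Membership.Propositional using (_∈_; _∉_; lose; find)
open import Data.List.Membership.Propositional.Properties
  using (∈-allFin; ∈-filter⁺; ∈-filter⁻; ∈-++⁺ˡ; ∈-++⁺ʳ; ∈-++⁻; ∈-∃++)
open import Data.List.NonEmpty as List⁺ using (List⁺; _∷_)
open import Data.List.Properties
  using (length-++; filter-accept; filter-none; length-filter; length-tabulate)
open import Data.List.Relation.Binary.Disjoint.Propositional using (Disjoint)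
open import Data.List.Relation.Binary.Permutation.Propositional
  using (_↭_; ↭-refl; ↭-sym; ↭-trans; ↭-reflexive; prep; ↭⇒↭ₛ)
open import Data.List.Relation.Binary.Permutation.Propositional.Properties
  using (∈-resp-↭; ↭-length; filter-↭; shift; ∷↭∷ʳ; ++⁺; ++⁺ʳ; ++⁺ˡ)
open import Data.List.Relation.Binary.Permutation.Setoid.Properties using (Unique-resp-↭)
open import Data.List.Relation.Binary.Subset.Propositional using (_⊆_)
open import Data.List.Relation.Unary.All as All using (All; []; _∷_)
open import Data.List.Relation.Unary.All.Properties using (¬Any⇒All¬; ++⁻ˡ; ++⁻ʳ)
open import Data.List.Relation.Unary.AllPairs using (AllPairs; []; _∷_)
open import Data.List.Relation.Unary.Any using (Any; here; there; any?)
open import Data.List.Relation.Unary.Linked using (Linked; [-]; _∷_)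
open import Data.List.Relation.Unary.Sorted.TotalOrder.Properties using (Sorted⇒AllPairs)
open import Data.List.Relation.Unary.Unique.Propositional using (Unique)
import Data.List.Relation.Unary.Unique.Propositional.Properties as Unique
open import Data.List.Sort using (sort-↭; sort-↗)
open import Data.Nat.Base
open import Data.Nat.Properties hiding (_≟_)
open import Data.Nat.Tactic.RingSolver using (solve-∀)
open import Data.Product.Base using (∃; ∃₂; _×_; _,_; proj₁; proj₂)
open import Data.Sum.Base using (_⊎_; inj₁; inj₂; [_,_]′; swap)
open import Data.Empty using (⊥-elim)
open import Function.Base using (_∘_; id)
open import Relation.Binary.Construct.Closure.ReflexiveTransitive using (Star; ε; _◅_; _◅◅_)
open import Relation.Binary.Construct.Closure.ReflexiveTransitive.Properties using (◅◅-assoc)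
open import Relation.Binary.Core using (Rel)
open import Relation.Binary.Definitions using (Symmetric)
open import Relation.Binary.PropositionalEquality
  using (_≡_; _≢_; refl; sym; trans; cong; cong₂; subst; setoid)
open import Level using (0ℓ)
open import Relation.Nullary using (¬_; ¬?; yes; no; contradiction)
open import Relation.Unary using (Pred; Decidable)

-- Lists without repetitions.

module _ {A : Set} where

  unique-↭ : {xs ys : List A} → xs ↭ ys → Unique xs → Unique ys
  unique-↭ p = Unique-resp-↭ (setoid A) (↭⇒↭ₛ p)

  unique-++⁻ : ∀ xs {ys : List A} → Unique (xs ++ ys) → Unique xs × Unique ys × Disjoint xs ys
  unique-++⁻ []       u = [] , u , λ ()
  unique-++⁻ (x ∷ xs) (x≢ ∷ u) with ux , uy , dis ← unique-++⁻ xs u =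
    (++⁻ˡ xs x≢ ∷ ux) , uy , λ where
      (here refl , q) → All.lookup (++⁻ʳ xs x≢) q refl
      (there p   , q) → dis (p , q)

  -- The pigeonhole principle, by cancelling each entry of `xs` against an occurrence in `ys`.
  unique⇒length≤ : {xs ys : List A} → Unique xs → xs ⊆ ys → length xs ≤ length ys
  unique⇒length≤ {[]}     _ _ = z≤n
  unique⇒length≤ {x ∷ xs} u@(_ ∷ uxs) sub
    with ys , zs , refl ← ∈-∃++ (sub (here refl)) =
    subst (suc (length xs) ≤_) (sym (↭-length (shift x ys zs)))
      (s≤s (unique⇒length≤ uxs sub′))
    where
    sub′ : xs ⊆ ys ++ zs
    sub′ p with ∈-resp-↭ (shift x ys zs) (sub (there p))
    ... | here refl = ⊥-elim (Unique.Unique[x∷xs]⇒x∉xs u p)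
    ... | there q   = q

-- Walks, their vertex lists and ways of cutting them.

module _ {A : Set} {R : Rel A 0ℓ} where

  -- sources omits the last vertex of a walk and targets the first one, so the sources of a
  -- closed walk are the vertices of a cycle.
  sources targets verts : ∀ {u v} → Star R u v → List A
  sources ε             = []
  sources (_◅_ {u} e p) = u ∷ sources p
  verts {u} p = u ∷ targets p
  targets ε       = []
  targets (e ◅ p) = verts p

  sources-◅◅ : ∀ {u v w} (p : Star R u v) (q : Star R v w) →
               sources (p ◅◅ q) ≡ sources p ++ sources q
  sources-◅◅ ε       q = refl
  sources-◅◅ (e ◅ p) q = cong (_ ∷_) (sources-◅◅ p q)

  verts-◅◅ : ∀ {u v w} (p : Star R u v) (q : Star R v w) →
             verts (p ◅◅ q) ≡ sources p ++ verts q
  verts-◅◅ ε       q = refl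
  verts-◅◅ {u} (e ◅ p) q = cong (u ∷_) (verts-◅◅ p q)

  targets-◅◅ : ∀ {u v w} (p : Star R u v) (q : Star R v w) →
               targets (p ◅◅ q) ≡ targets p ++ targets q
  targets-◅◅ ε       q = refl
  targets-◅◅ (_◅_ {j = j} e p) q = cong (j ∷_) (targets-◅◅ p q)

  verts-++⁻ : ∀ {u v w k} (p : Star R u v) (q : Star R v w) →
              k ∈ verts (p ◅◅ q) → k ∈ verts p ⊎ k ∈ targets q
  verts-++⁻ {u = u} {k = k} p q i =
    ∈-++⁻ (verts p) (subst (k ∈_) (cong (u ∷_) (targets-◅◅ p q)) i)

  verts-∷ʳ : ∀ {u v} (p : Star R u v) → verts p ≡ sources p ∷ʳ v
  verts-∷ʳ ε       = refl
  verts-∷ʳ {u} (e ◅ p) = cong (u ∷_) (verts-∷ʳ p)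

  verts-◅◅-◅ : ∀ {u v w x} (p : Star R u v) (e : R v w) (q : Star R w x) →
               verts (p ◅◅ (e ◅ q)) ≡ verts p ++ verts q
  verts-◅◅-◅ ε       e q = refl
  verts-◅◅-◅ {u} (_ ◅ p) e q = cong (u ∷_) (verts-◅◅-◅ p e q)

  length-targets : ∀ {u v} (p : Star R u v) → length (targets p) ≡ length (sources p)
  length-targets ε       = refl
  length-targets (e ◅ p) = cong suc (length-targets p)

  last∈verts : ∀ {u v} (p : Star R u v) → v ∈ verts p
  last∈verts ε       = here refl
  last∈verts (e ◅ p) = there (last∈verts p)

  source⇒vert : ∀ {u v} (p : Star R u v) → sources p ⊆ verts p
  source⇒vert (e ◅ p) (here eq) = here eq
  source⇒vert (e ◅ p) (there i) = there (source⇒vert p i)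

  vert⇒source : ∀ {u v w} (p : Star R u v) → w ∈ verts p → w ∈ sources p ⊎ w ≡ v
  vert⇒source ε       (here eq) = inj₂ eq
  vert⇒source (e ◅ p) (here eq) = inj₁ (here eq)
  vert⇒source (e ◅ p) (there i) with vert⇒source p i
  ... | inj₁ s = inj₁ (there s)
  ... | inj₂ t = inj₂ t

  unique-sources : ∀ {u v} (p : Star R u v) → Unique (verts p) →
                   Unique (sources p) × v ∉ sources p
  unique-sources p u
    with us , _ , dis ← unique-++⁻ (sources p) (subst Unique (verts-∷ʳ p) u) =
    us , λ v∈ → dis (v∈ , here refl)

  split-∈ : ∀ {u v w} (p : Star R u v) → w ∈ verts p →
            ∃₂ λ (p₁ : Star R u w) (p₂ : Star R w v) → p ≡ p₁ ◅◅ p₂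
  split-∈ p       (here refl) = ε , p , refl
  split-∈ (e ◅ p) (there i) with p₁ , p₂ , refl ← split-∈ p i = e ◅ p₁ , p₂ , refl

  suffix-∈ : ∀ {u v w} (p : Star R u v) → Unique (verts p) → w ∈ verts p →
             ∃ λ (q : Star R w v) → Unique (verts q) ×
               verts q ⊆ verts p × sources q ⊆ sources p × targets q ⊆ targets p
  suffix-∈ p       u       (here refl) = p , u , id , id , id
  suffix-∈ (e ◅ p) (_ ∷ u) (there i) with q , uq , vs , ss , ts ← suffix-∈ p u i =
    q , uq , there ∘ vs , there ∘ ss , there ∘ ts

  suffix-targets : ∀ {u v w} (p : Star R u v) → Unique (verts p) → w ∈ targets p →
                   ∃ λ (q : Star R w v) → Unique (verts q) ×
                     verts q ⊆ targets p × sources q ⊆ sources p × targets q ⊆ targets p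
  suffix-targets (e ◅ p) (_ ∷ u) i with q , uq , vs , ss , ts ← suffix-∈ p u i =
    q , uq , vs , there ∘ ss , there ∘ ts

  module _ {P : Pred A 0ℓ} (P? : Decidable P) where

    split-first : ∀ {u v} (p : Star R u v) → Any P (verts p) →
                  ∃ λ w → ∃₂ λ (p₁ : Star R u w) (p₂ : Star R w v) →
                  p ≡ p₁ ◅◅ p₂ × P w × All (¬_ ∘ P) (sources p₁)
    split-first {u} p i with P? u
    ... | yes Pu = u , ε , p , refl , Pu , []
    split-first p       (here Pu) | no ¬Pu = contradiction Pu ¬Pu
    split-first (e ◅ p) (there i) | no ¬Pu
      with w , p₁ , p₂ , refl , Pw , free ← split-first p i =
      w , e ◅ p₁ , p₂ , refl , Pw , ¬Pu ∷ free

    split-last : ∀ {u v} (p : Star R u v) → Any P (verts p) →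
                 ∃ λ w → ∃₂ λ (p₁ : Star R u w) (p₂ : Star R w v) →
                 p ≡ p₁ ◅◅ p₂ × P w × All (¬_ ∘ P) (targets p₂)
    split-last {u} p i with any? P? (targets p)
    split-last {u} p (here Pu) | no none = u , ε , p , refl , Pu , ¬Any⇒All¬ _ none
    split-last {u} p (there i) | no none = contradiction i none
    split-last (e ◅ p) _ | yes i
      with w , p₁ , p₂ , refl , Pw , free ← split-last p i =
      w , e ◅ p₁ , p₂ , refl , Pw , free

  -- Consecutive pairs and crossings on a walk.

  data Consecutive (P Q : Pred A 0ℓ) {u v : A} : Star R u v → Set where
    consecutive : ∀ {i j} (q₁ : Star R u i) (e : R i j) (q₂ : Star R j v) →
                  P i → Q j → Consecutive P Q (q₁ ◅◅ (e ◅ q₂))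

  -- A closest pair: the vertices strictly between are the sources of `m`, and an empty `m` makes
  -- the two ends consecutive on the walk.
  data Crossing (P Q : Pred A 0ℓ) {u v : A} : Star R u v → Set where
    crossing : ∀ {i k j} (q₁ : Star R u i) (e : R i k) (m : Star R k j) (q₂ : Star R j v) →
               P i → Q j → All (¬_ ∘ P) (sources m) → All (¬_ ∘ Q) (sources m) →
               Crossing P Q (q₁ ◅◅ (e ◅ (m ◅◅ q₂)))

  module _ {P Q : Pred A 0ℓ} where

    consecutive-◅ : ∀ {u v w} (e : R u v) {p : Star R v w} →
                    Consecutive P Q p → Consecutive P Q (e ◅ p)
    consecutive-◅ e (consecutive q₁ e′ q₂ Pi Qj) = consecutive (e ◅ q₁) e′ q₂ Pi Qj

    crossing-◅ : ∀ {u v w} (e : R u v) {p : Star R v w} → Crossing P Q p → Crossing P Q (e ◅ p)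
    crossing-◅ e (crossing q₁ e′ m q₂ Pi Qj ¬P ¬Q) = crossing (e ◅ q₁) e′ m q₂ Pi Qj ¬P ¬Q

    crossing-◅◅ : ∀ {u v w} (p : Star R u v) {q : Star R v w} →
                  Crossing P Q q → Crossing P Q (p ◅◅ q)
    crossing-◅◅ ε       cr = cr
    crossing-◅◅ (e ◅ p) cr = crossing-◅ e (crossing-◅◅ p cr)

  module _ {Q : Pred A 0ℓ} (Q? : Decidable Q) where

    predecessors : ∀ {u v} → Star R u v → List A
    predecessors ε = []
    predecessors (_◅_ {u} {w} e p) with Q? w
    ... | yes _ = u ∷ predecessors p
    ... | no  _ = predecessors p

    predecessors⊆sources : ∀ {u v} (p : Star R u v) → predecessors p ⊆ sources p
    predecessors⊆sources (_◅_ {j = w} e p) i with Q? w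
    predecessors⊆sources (e ◅ p) (here eq) | yes _ = here eq
    predecessors⊆sources (e ◅ p) (there i) | yes _ = there (predecessors⊆sources p i)
    predecessors⊆sources (e ◅ p) i         | no  _ = there (predecessors⊆sources p i)

    predecessors-unique : ∀ {u v} (p : Star R u v) → Unique (sources p) →
                          Unique (predecessors p)
    predecessors-unique ε u = []
    predecessors-unique (_◅_ {j = w} e p) (u∉ ∷ u) with Q? w
    ... | yes _ = All.tabulate (All.lookup u∉ ∘ predecessors⊆sources p)
                  ∷ predecessors-unique p u
    ... | no  _ = predecessors-unique p u

    length-predecessors : ∀ {u v} (p : Star R u v) →
                          length (predecessors p) ≡ length (filter Q? (targets p))
    length-predecessors ε = refl
    length-predecessors (_◅_ {j = w} e p) with Q? w
    ... | yes _ = cong suc (length-predecessors p)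
    ... | no  _ = length-predecessors p

    ∈-predecessors : ∀ {u v w} (p : Star R u v) → w ∈ predecessors p →
                     Consecutive (w ≡_) Q p
    ∈-predecessors (_◅_ {j = w} e p) i with Q? w
    ∈-predecessors (e ◅ p) (here refl) | yes Qw = consecutive ε e p refl Qw
    ∈-predecessors (e ◅ p) (there i)   | yes _  = consecutive-◅ e (∈-predecessors p i)
    ∈-predecessors (e ◅ p) i           | no  _  = consecutive-◅ e (∈-predecessors p i)

  module _ {P Q : Pred A 0ℓ} (P? : Decidable P) (Q? : Decidable Q) where

    -- An edge with source in `P` and target in `Q` is a consecutive pair. Without such edges each
    -- edge is counted at most once, and a walk has as many edges as sources.
    consecutive-or-sparse : ∀ {u v} (p : Star R u v) → Consecutive P Q p ⊎
      length (filter P? (sources p)) + length (filter Q? (targets p)) ≤ length (sources p)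
    consecutive-or-sparse ε = inj₂ z≤n
    consecutive-or-sparse (_◅_ {u} {w} e p) with consecutive-or-sparse p
    ... | inj₁ con = inj₁ (consecutive-◅ e con)
    ... | inj₂ b with P? u | Q? w
    ...   | yes Pu | yes Qw = inj₁ (consecutive ε e p Pu Qw)
    ...   | yes _  | no  _  = inj₂ (s≤s b)
    ...   | no  _  | yes _  = inj₂ (≤-trans (≤-reflexive (+-suc _ _)) (s≤s b))
    ...   | no  _  | no  _  = inj₂ (m≤n⇒m≤1+n b)

    -- Scanning from the far end: as long as there is no crossing, the first vertex of Q has
    -- no vertex of P before it, so a new vertex of P gives a crossing with free interior.
    crossing-or-first : ∀ {u v} (p : Star R u v) → Crossing P Q p ⊎
      (∃ λ w → ∃₂ λ (p₁ : Star R u w) (p₂ : Star R w v) → p ≡ p₁ ◅◅ p₂ × Q w ×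
        All (¬_ ∘ P) (sources p₁) × All (¬_ ∘ Q) (sources p₁)) ⊎
      All (¬_ ∘ Q) (verts p)
    crossing-or-first {u} p with Q? u
    ... | yes Qu = inj₂ (inj₁ (u , ε , p , refl , Qu , [] , []))
    crossing-or-first ε | no ¬Qu = inj₂ (inj₂ (¬Qu ∷ []))
    crossing-or-first {u} (e ◅ p) | no ¬Qu with crossing-or-first p
    ... | inj₁ cr = inj₁ (crossing-◅ e cr)
    ... | inj₂ (inj₂ ¬Q) = inj₂ (inj₂ (¬Qu ∷ ¬Q))
    ... | inj₂ (inj₁ (w , p₁ , p₂ , refl , Qw , ¬P , ¬Q)) with P? u
    ...   | yes Pu = inj₁ (crossing ε e p₁ p₂ Pu Qw ¬P ¬Q)
    ...   | no ¬Pu = inj₂ (inj₁ (w , e ◅ p₁ , p₂ , refl , Qw , ¬Pu ∷ ¬P , ¬Qu ∷ ¬Q))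

    -- Cut at the first vertex `t` of `P`. A vertex of `Q` after it forces a crossing: one inside
    -- the remainder or, when no vertex of `P` lies between, one starting at `t`.
    crossing-or-separated : ∀ {u v} (p : Star R u v) → Any P (verts p) → Crossing P Q p ⊎
      (∃ λ t → ∃₂ λ (p₁ : Star R u t) (p₂ : Star R t v) → p ≡ p₁ ◅◅ p₂ × P t ×
        All (¬_ ∘ P) (sources p₁) × All (¬_ ∘ Q) (targets p₂))
    crossing-or-separated p some with split-first P? p some
    ... | t , p₁ , ε , refl , Pt , ¬P = inj₂ (t , p₁ , ε , refl , Pt , ¬P , [])
    ... | t , p₁ , e ◅ p₂ , refl , Pt , ¬P with crossing-or-first p₂
    ...   | inj₁ cr = inj₁ (crossing-◅◅ p₁ (crossing-◅ e cr))
    ...   | inj₂ (inj₁ (w , r₁ , r₂ , refl , Qw , ¬P′ , ¬Q)) =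
      inj₁ (crossing p₁ e r₁ r₂ Pt Qw ¬P′ ¬Q)
    ...   | inj₂ (inj₂ ¬Q) = inj₂ (t , p₁ , e ◅ p₂ , refl , Pt , ¬P , ¬Q)

-- Reversal and rotation of walks.

module _ {A : Set} {R : Rel A 0ℓ} (R-sym : Symmetric R) where

  rev : ∀ {u v} → Star R u v → Star R v u
  rev ε       = ε
  rev (e ◅ p) = rev p ◅◅ (R-sym e ◅ ε)

  sources-rev : ∀ {u v} (p : Star R u v) → sources (rev p) ↭ targets p
  sources-rev ε = ↭-refl
  sources-rev {u} (_◅_ {j = w} e p) =
    ↭-trans (↭-reflexive (sources-◅◅ (rev p) (R-sym e ◅ ε)))
      (↭-trans (↭-sym (∷↭∷ʳ w (sources (rev p)))) (prep w (sources-rev p)))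

  verts-rev : ∀ {u v} (p : Star R u v) → verts (rev p) ↭ verts p
  verts-rev {u} p =
    ↭-trans (↭-reflexive (verts-∷ʳ (rev p)))
      (↭-trans (↭-sym (∷↭∷ʳ u (sources (rev p)))) (prep u (sources-rev p)))

  -- Pósa rotation: the chord `a` replaces the edge `e`, and `u` becomes the new first vertex.
  rotation : ∀ {x u w v} (q₁ : Star R x u) (q₂ : Star R w v) (e : R u w) (a : R x w) →
             verts (rev q₁ ◅◅ (a ◅ q₂)) ↭ verts (q₁ ◅◅ (e ◅ q₂))
  rotation q₁ q₂ e a =
    ↭-trans (↭-reflexive (verts-◅◅-◅ (rev q₁) a q₂))
      (↭-trans (++⁺ʳ (verts q₂) (verts-rev q₁))
        (↭-reflexive (sym (verts-◅◅-◅ q₁ e q₂))))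

-- Degrees and the degree sequence.

length-filter-map : ∀ {A B : Set} {P : Pred B 0ℓ} (P? : Decidable P) (f : A → B) xs →
                    length (filter P? (map f xs)) ≡ length (filter (P? ∘ f) xs)
length-filter-map P? f []       = refl
length-filter-map P? f (x ∷ xs) with P? (f x)
... | yes _ = cong suc (length-filter-map P? f xs)
... | no  _ = length-filter-map P? f xs

-- In a sorted list the entries that are at most `D` come first. For `k = 0` the value is the junk 0
-- of `term`.
term-≤ : ∀ {xs D} k → AllPairs _≤_ xs → k ≤ length (filter (_≤? D) xs) → term xs k ≤ D
term-≤ {[]}         k             _         _ = z≤n
term-≤ {x ∷ xs}     zero          _         _ = z≤n
term-≤ {x ∷ xs} {D} (suc k)       (x≤ ∷ ↗) k≤ with x ≤? D
term-≤ {x ∷ xs} {D} (suc zero)    (x≤ ∷ ↗) k≤ | yes x≤D = x≤D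
term-≤ {x ∷ xs} {D} (suc (suc k)) (x≤ ∷ ↗) k≤ | yes x≤D = term-≤ (suc k) ↗
  (s≤s⁻¹ (subst (λ ys → suc (suc k) ≤ length ys) (filter-accept (_≤? D) x≤D) k≤))
-- Already the smallest entry exceeds `D`, so nothing is counted.
term-≤ {x ∷ xs} {D} (suc k)       (x≤ ∷ ↗) k≤ | no x≰D
  with () ← subst (λ ys → suc k ≤ length ys)
              (filter-none (_≤? D) (x≰D ∷ All.map (λ x≤y y≤D → x≰D (≤-trans x≤y y≤D)) x≤)) k≤

module _ {n : ℕ} (G : Graph n) where
  open Graph G
  open import Data.List.Membership.DecPropositional (_≟_ {n}) using (_∈?_)

  -- The proof uses the degree sequence only through this bound. Sorting permutes the degrees, so
  -- counting small terms is counting vertices of small degree.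
  d-≤ : ∀ {X D} k → Unique X → (∀ {v} → v ∈ X → degree G v ≤ D) → k ≤ length X → d G k ≤ D
  d-≤ {X} {D} k uX small k≤ = term-≤ k
    (Sorted⇒AllPairs ≤-totalOrder (sort-↗ ≤-decTotalOrder degrees)) (begin
      k                                                ≤⟨ k≤ ⟩
      length X                                         ≤⟨ unique⇒length≤ uX
        (λ {v} v∈X → ∈-filter⁺ ((_≤? D) ∘ degree G) (∈-allFin v) (small v∈X)) ⟩
      length (filter ((_≤? D) ∘ degree G) (allFin n))  ≡⟨ length-filter-map (_≤? D) (degree G) (allFin n) ⟨
      length (filter (_≤? D) degrees)                  ≡⟨ ↭-length (filter-↭ (_≤? D)
        (sort-↭ ≤-decTotalOrder degrees)) ⟨
      length (filter (_≤? D) (degreeSequence G))       ∎)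
    where
    open ≤-Reasoning
    degrees : List ℕ
    degrees = map (degree G) (allFin n)

  δ≤degree : ∀ v → δ G ≤ degree G v
  δ≤degree v = d-≤ {[ v ]} 1 ([] ∷ []) (λ where (here refl) → ≤-refl) ≤-refl

  degree≤n : ∀ v → degree G v ≤ n
  degree≤n v = subst (degree G v ≤_) (length-tabulate {n = n} id)
    (length-filter (adj? v) (allFin n))

  neighbours : Fin n → List (Fin n)
  neighbours v = filter (adj? v) (allFin n)

  neighbours-unique : ∀ v → Unique (neighbours v)
  neighbours-unique v = Unique.filter⁺ (adj? v) (Unique.allFin⁺ n)

  neighbours-adj : ∀ v {w} → w ∈ neighbours v → Adj v w
  neighbours-adj v i = proj₂ (∈-filter⁻ (adj? v) {xs = allFin n} i)

  degree-≤ : ∀ {v ys} → (∀ {w} → Adj v w → w ∈ ys) → degree G v ≤ length ys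
  degree-≤ {v} nbrs = unique⇒length≤ (neighbours-unique v) (nbrs ∘ neighbours-adj v)

  -- By irreflexivity `v` adds one to the count of its neighbours.
  degree-< : ∀ {v ys} → v ∈ ys → (∀ {w} → Adj v w → w ∈ ys) → degree G v < length ys
  degree-< {v} v∈ nbrs = unique⇒length≤
    (All.tabulate (λ i → λ { refl → irrefl refl (neighbours-adj v i) }) ∷ neighbours-unique v)
    (λ { (here refl) → v∈ ; (there i) → nbrs (neighbours-adj v i) })

  last-adj : ∀ {u v w} (e : Adj u v) (p : Star Adj v w) → ∃ (Adj w)
  last-adj e ε        = _ , symm e
  last-adj e (e′ ◅ p) = last-adj e′ p

  linked-verts : ∀ {u v} (p : Star Adj u v) → Linked Adj (verts p)
  linked-verts ε             = [-]
  linked-verts (e ◅ ε)       = e ∷ [-]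
  linked-verts (e ◅ e′ ◅ p) = e ∷ linked-verts (e′ ◅ p)

  linked⇒walk : ∀ {x xs} → Linked Adj (x ∷ xs) → ∃₂ λ y (p : Star Adj x y) → verts p ≡ x ∷ xs
  linked⇒walk [-]     = _ , ε , refl
  linked⇒walk (e ∷ l) with y , p , refl ← linked⇒walk l = y , e ◅ p , refl

  -- Longest paths with heavy ends.

  module LongestPath (m : ℕ) (path≤m : ∀ xs → IsPath G xs → List⁺.length xs ≤ m) where

    Longest : ∀ {x y} → Star Adj x y → Set
    Longest p = Unique (verts p) × length (verts p) ≡ m

    longest-↭ : ∀ {x y u v} {p : Star Adj x y} {q : Star Adj u v} →
                verts p ↭ verts q → Longest p → Longest q
    longest-↭ p↭q (u , len) = unique-↭ p↭q u , trans (sym (↭-length p↭q)) len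

    -- Otherwise prepending `w` would give a longer path.
    neighbour∈longest : ∀ {x y} (p : Star Adj x y) → Longest p → ∀ {w} → Adj x w → w ∈ verts p
    neighbour∈longest p (u , len) {w} a with w ∈? verts p
    ... | yes i = i
    ... | no ¬i = contradiction
      (path≤m (w ∷ verts p) ((¬Any⇒All¬ _ ¬i ∷ u) , linked-verts (symm a ◅ p)))
      (<⇒≱ (s≤s (≤-reflexive (sym len))))

    neighbour∈targets : ∀ {x y} (p : Star Adj x y) → Longest p → ∀ {w} → Adj x w → w ∈ targets p
    neighbour∈targets p lp a with neighbour∈longest p lp a
    ... | here refl = ⊥-elim (irrefl refl a)
    ... | there i   = i

    neighbour∈longest′ : ∀ {x y} (p : Star Adj x y) → Longest p → ∀ {w} → Adj y w → w ∈ verts p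
    neighbour∈longest′ p lp a = ∈-resp-↭ (verts-rev symm p)
      (neighbour∈longest (rev symm p) (longest-↭ (↭-sym (verts-rev symm p)) lp) a)

    -- The predecessors of the neighbours of x can replace x as an end of a longest path.
    improve : ∀ {x y} (p : Star Adj x y) → Longest p →
      (∃₂ λ u (q : Star Adj u y) → Longest q × degree G x < degree G u) ⊎
      (∃ λ X → Unique X × X ⊆ sources p × degree G x ≤ length X ×
               (∀ {v} → v ∈ X → degree G v ≤ degree G x))
    improve {x} p lp@(u , _) with any? (λ v → degree G x <? degree G v) (predecessors (adj? x) p)
    ... | no none =
      inj₂ (X , predecessors-unique (adj? x) p (proj₁ (unique-sources p u))
          , predecessors⊆sources (adj? x) p
          , subst (degree G x ≤_) (sym (length-predecessors (adj? x) p))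
              (degree-≤ (λ a → ∈-filter⁺ (adj? x) (neighbour∈targets p lp a) a))
          , λ i → ≮⇒≥ (All.lookup (¬Any⇒All¬ X none) i))
      where
      X : List (Fin n)
      X = predecessors (adj? x) p
    ... | yes some with v , v∈ , lt ← find some
      with consecutive q₁ e q₂ refl a ← ∈-predecessors (adj? x) p v∈ =
      inj₁ (v , rev symm q₁ ◅◅ (a ◅ q₂) , longest-↭ (↭-sym (rotation symm q₁ q₂ e a)) lp , lt)

    -- `Y` bounds the term at `δ`, and `X` together with `y` bounds the next one. The vertex `y` is
    -- new because `X` consists of sources of a path that ends in `y`.
    heavy-ends : ∀ {x y} (p : Star Adj x y) → Longest p → ∀ {X Y} → degree G y ≤ degree G x →
            Unique X → X ⊆ sources p → degree G x ≤ length X →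
            (∀ {v} → v ∈ X → degree G v ≤ degree G x) →
            Unique Y → degree G y ≤ length Y →
            (∀ {v} → v ∈ Y → degree G v ≤ degree G y) →
            d G (δ G) + d G (suc (δ G)) ≤ degree G y + degree G x
    heavy-ends {x} {y} p (u , _) y≤x uX X⊆ x≤X X≤ uY y≤Y Y≤ = +-mono-≤
      (d-≤ (δ G) uY Y≤ (≤-trans (δ≤degree y) y≤Y))
      (d-≤ (suc (δ G))
        (All.tabulate (λ i → λ { refl → proj₂ (unique-sources p u) (X⊆ i) }) ∷ uX)
        (λ { (here refl) → y≤x ; (there i) → X≤ i })
        (s≤s (≤-trans (δ≤degree x) x≤X)))

    -- `k` is fuel for the replacement of ends: each one raises the sum of the end degrees, which
    -- never exceeds `n + n`.
    heavyLongest : ∀ k {x y} (p : Star Adj x y) → Longest p →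
      n + n ≤ k + (degree G x + degree G y) →
      ∃₂ λ x y → ∃ λ (p : Star Adj x y) → Longest p ×
        d G (δ G) + d G (suc (δ G)) ≤ degree G x + degree G y
    heavyLongest k {x} {y} p lp bound
      with improve p lp | improve (rev symm p) (longest-↭ (↭-sym (verts-rev symm p)) lp)
    ... | inj₁ (u , q , lq , lt) | _ = continue k bound
      where
      continue : ∀ k → n + n ≤ k + (degree G x + degree G y) → _
      -- Without fuel the sum is already at least `n + n`, so it cannot increase.
      continue zero    b = contradiction (+-mono-≤ (degree≤n u) (degree≤n y))
        (<⇒≱ (≤-<-trans b (+-monoˡ-< (degree G y) lt)))
      continue (suc k) b = heavyLongest k q lq
        (≤-trans b (subst (_≤ k + (degree G u + degree G y)) (+-suc k _)
          (+-monoʳ-≤ k (+-monoˡ-< (degree G y) lt))))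
    -- The other end is improved on the reversed path, so the new path runs from `u` to `x`.
    ... | inj₂ _ | inj₁ (u , q , lq , lt) = continue k bound
      where
      continue : ∀ k → n + n ≤ k + (degree G x + degree G y) → _
      continue zero    b = contradiction (+-mono-≤ (degree≤n x) (degree≤n u))
        (<⇒≱ (≤-<-trans b (+-monoʳ-< (degree G x) lt)))
      continue (suc k) b = heavyLongest k q lq
        (≤-trans b (subst (_≤ k + (degree G u + degree G x)) (+-suc k _)
          (+-monoʳ-≤ k (subst (degree G x + degree G y <_) (+-comm (degree G x) _)
            (+-monoʳ-< (degree G x) lt)))))
    ... | inj₂ (X , uX , X⊆ , x≤ , X≤) | inj₂ (Y , uY , Y⊆ , y≤ , Y≤)
      with ≤-total (degree G y) (degree G x)
    ... | inj₁ y≤x = x , y , p , lp ,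
      subst (d G (δ G) + d G (suc (δ G)) ≤_) (+-comm (degree G y) _)
        (heavy-ends p lp y≤x uX X⊆ x≤ X≤ uY y≤ Y≤)
    ... | inj₂ x≤y = x , y , p , lp ,
      heavy-ends (rev symm p) (longest-↭ (↭-sym (verts-rev symm p)) lp) x≤y uY Y⊆ y≤ Y≤ uX x≤ X≤

  -- Cycles from crossing neighbours.

  module LongestCycle (c : ℕ) (3≤c : 3 ≤ c)
                      (cycle≤c : ∀ xs → IsCycle G xs → List⁺.length xs ≤ c) where

    -- A closed walk with fewer than three sources is no cycle, but `3 ≤ c` covers it, so later
    -- constructions can leave their length unchecked.
    closed-walk≤c : ∀ {u} (p : Star Adj u u) → Unique (sources p) → length (sources p) ≤ c
    closed-walk≤c     ε       _ = z≤n
    closed-walk≤c {u} (e ◅ p) uniq with 3 ≤? length (sources (e ◅ p))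
    ... | no  3≰ = ≤-trans (<⇒≤ (≰⇒> 3≰)) 3≤c
    ... | yes 3≤ = cycle≤c (u ∷ sources p)
      (3≤ , uniq , subst (Linked Adj) (verts-∷ʳ (e ◅ p)) (linked-verts (e ◅ p)))

    closed-path≤c : ∀ {u v} (p : Star Adj u v) → Unique (verts p) → Adj v u →
                    length (verts p) ≤ c
    closed-path≤c p uniq a = subst (λ xs → length xs ≤ c) sources≡
      (closed-walk≤c (p ◅◅ (a ◅ ε)) (subst Unique (sym sources≡) uniq))
      where
      sources≡ : sources (p ◅◅ (a ◅ ε)) ≡ verts p
      sources≡ = trans (sources-◅◅ p (a ◅ ε)) (sym (verts-∷ʳ p))

    -- The cycle runs from `i` back to `x`, over the chord to `j`, on to `y` and over the other
    -- chord to `i`.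
    crossing-cycle : ∀ {x i j y} (q₁ : Star Adj x i) (q₂ : Star Adj j y) →
                     Unique (verts q₁ ++ verts q₂) → Adj y i → Adj x j →
                     length (verts q₁ ++ verts q₂) ≤ c
    crossing-cycle q₁ q₂ uniq y~i x~j = subst (_≤ c) (sym (↭-length perm))
      (closed-path≤c (rev symm q₁ ◅◅ (x~j ◅ q₂)) (unique-↭ perm uniq) y~i)
      where
      perm : verts q₁ ++ verts q₂ ↭ verts (rev symm q₁ ◅◅ (x~j ◅ q₂))
      perm = ↭-sym (↭-trans (↭-reflexive (verts-◅◅-◅ (rev symm q₁) x~j q₂))
               (++⁺ʳ (verts q₂) (verts-rev symm q₁)))

    -- Nothing lies between the two parts, so the crossing cycle takes in the whole path.
    consecutive≤c : ∀ {x y} {p : Star Adj x y} → Unique (verts p) →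
                    Consecutive (Adj y) (Adj x) p → length (verts p) ≤ c
    consecutive≤c uniq (consecutive q₁ e q₂ y~i x~j) =
      subst (λ xs → length xs ≤ c) (sym (verts-◅◅-◅ q₁ e q₂))
        (crossing-cycle q₁ q₂ (subst Unique (verts-◅◅-◅ q₁ e q₂) uniq) y~i x~j)

    -- A consecutive pair on `q₁` or `q₂` gives a cycle through the whole path. Otherwise the sparse
    -- counts apply to both, and the interior of the crossing, which the cycle skips, contributes to
    -- neither degree.
    crossing≤c : ∀ {x y} {p : Star Adj x y} → Unique (verts p) →
                 (∀ {w} → Adj x w → w ∈ verts p) → (∀ {w} → Adj y w → w ∈ verts p) →
                 Crossing (Adj y) (Adj x) p →
                 length (verts p) ≤ c ⊎ degree G x + degree G y ≤ c
    crossing≤c {x} {y} uniq Nx⊆ Ny⊆ (crossing {i} {k} {j} q₁ e m q₂ y~i x~j ¬y ¬x)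
      with consecutive-or-sparse (adj? y) (adj? x) q₁ | consecutive-or-sparse (adj? y) (adj? x) q₂
    ... | inj₁ (consecutive a e′ b y~ x~) | _ = inj₁ (consecutive≤c uniq
      (subst (Consecutive (Adj y) (Adj x)) (sym (◅◅-assoc a (e′ ◅ b) (e ◅ (m ◅◅ q₂))))
        (consecutive a e′ (b ◅◅ (e ◅ (m ◅◅ q₂))) y~ x~)))
    ... | inj₂ _ | inj₁ (consecutive a e′ b y~ x~) = inj₁ (consecutive≤c uniq
      (subst (Consecutive (Adj y) (Adj x)) assoc
        (consecutive (q₁ ◅◅ (e ◅ (m ◅◅ a))) e′ b y~ x~)))
      where
      assoc : (q₁ ◅◅ (e ◅ (m ◅◅ a))) ◅◅ (e′ ◅ b) ≡ q₁ ◅◅ (e ◅ (m ◅◅ (a ◅◅ (e′ ◅ b))))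
      assoc = trans (◅◅-assoc q₁ (e ◅ (m ◅◅ a)) (e′ ◅ b))
                (cong (λ z → q₁ ◅◅ (e ◅ z)) (◅◅-assoc m a (e′ ◅ b)))
    ... | inj₂ b₁ | inj₂ b₂ = inj₂ (begin
      degree G x + degree G y
        ≤⟨ +-mono-≤ (degree-≤ Nx⊆′) (degree-≤ Ny⊆′) ⟩
      length (X₁ ++ j ∷ X₂) + length (Y₁ ++ i ∷ Y₂)
        ≡⟨ cong₂ _+_ (length-++ X₁) (length-++ Y₁) ⟩
      (length X₁ + suc (length X₂)) + (length Y₁ + suc (length Y₂))
        -- The inner `suc` terms stand for `j` and `i`; regrouped, they match the one vertex by
        -- which each part exceeds its number of edges.
        ≡⟨ arrange (length X₁) (length X₂) (length Y₁) (length Y₂) ⟩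
      suc (length Y₁ + length X₁) + suc (length Y₂ + length X₂)
        ≤⟨ +-mono-≤ (s≤s b₁) (s≤s b₂) ⟩
      suc (length (sources q₁)) + suc (length (sources q₂))
        ≡⟨ cong₂ (λ a b → suc a + suc b) (length-targets q₁) (length-targets q₂) ⟨
      length (verts q₁) + length (verts q₂)
        ≡⟨ length-++ (verts q₁) ⟨
      length (verts q₁ ++ verts q₂)
        ≤⟨ crossing-cycle q₁ q₂ uniq′ y~i x~j ⟩
      c ∎)
      where
      open ≤-Reasoning
      -- Sources and targets are chosen as in the sparse count. The ends left out are `x` and `y`,
      -- not adjacent to themselves, and `j` and `i`, which are added by hand.
      X₁ = filter (adj? x) (targets q₁)
      X₂ = filter (adj? x) (targets q₂)
      Y₁ = filter (adj? y) (sources q₁)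
      Y₂ = filter (adj? y) (sources q₂)

      arrange : ∀ a b c d → (a + suc b) + (c + suc d) ≡ suc (c + a) + suc (d + b)
      arrange = solve-∀

      verts≡ : verts (q₁ ◅◅ (e ◅ (m ◅◅ q₂))) ≡ verts q₁ ++ (sources m ++ verts q₂)
      verts≡ = trans (verts-◅◅-◅ q₁ e (m ◅◅ q₂)) (cong (verts q₁ ++_) (verts-◅◅ m q₂))

      located : ∀ {w} → w ∈ verts (q₁ ◅◅ (e ◅ (m ◅◅ q₂))) →
                w ∈ verts q₁ ⊎ w ∈ sources m ⊎ w ∈ verts q₂
      located {w} w∈ with ∈-++⁻ (verts q₁) (subst (w ∈_) verts≡ w∈)
      ... | inj₁ i = inj₁ i
      ... | inj₂ i = inj₂ (∈-++⁻ (sources m) i)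

      Nx⊆′ : ∀ {w} → Adj x w → w ∈ X₁ ++ j ∷ X₂
      Nx⊆′ a with located (Nx⊆ a)
      ... | inj₁ (here refl)         = ⊥-elim (irrefl refl a)
      ... | inj₁ (there i)           = ∈-++⁺ˡ (∈-filter⁺ (adj? x) i a)
      ... | inj₂ (inj₁ i)            = contradiction a (All.lookup ¬x i)
      ... | inj₂ (inj₂ (here refl)) = ∈-++⁺ʳ X₁ (here refl)
      ... | inj₂ (inj₂ (there i))   = ∈-++⁺ʳ X₁ (there (∈-filter⁺ (adj? x) i a))

      Ny⊆′ : ∀ {w} → Adj y w → w ∈ Y₁ ++ i ∷ Y₂
      Ny⊆′ a with located (Ny⊆ a)
      ... | inj₁ w∈ with vert⇒source q₁ w∈
      ...   | inj₁ s    = ∈-++⁺ˡ (∈-filter⁺ (adj? y) s a)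
      ...   | inj₂ refl = ∈-++⁺ʳ Y₁ (here refl)
      Ny⊆′ a | inj₂ (inj₁ w∈) = contradiction a (All.lookup ¬y w∈)
      Ny⊆′ a | inj₂ (inj₂ w∈) with vert⇒source q₂ w∈
      ...   | inj₁ s    = ∈-++⁺ʳ Y₁ (there (∈-filter⁺ (adj? y) s a))
      ...   | inj₂ refl = ⊥-elim (irrefl refl a)

      uniq′ : Unique (verts q₁ ++ verts q₂)
      uniq′ with u₁ , u₂ , dis ← unique-++⁻ (verts q₁) (subst Unique verts≡ uniq)
        with _ , u₃ , _ ← unique-++⁻ (sources m) u₂ =
        Unique.++⁺ u₁ u₃ λ (a , b) → dis (a , ∈-++⁺ʳ (sources m) b)

  -- Links between two vertex sets avoiding a vertex.

  record Link (z : Fin n) (U V : List (Fin n)) : Set where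
    field
      {start end} : Fin n
      path        : Star Adj start end
      start∈      : start ∈ V
      end∈        : end ∈ U
      unique      : Unique (verts path)
      sources∉    : ∀ {k} → k ∈ sources path → k ∉ U
      targets∉    : ∀ {k} → k ∈ targets path → k ∉ V
      z∉          : z ∉ verts path

  module _ {z : Fin n} {U V : List (Fin n)} where

    -- Scanning the walk from its far end maintains a path `q` to `U` that avoids `V`. It restarts
    -- at a vertex of `U`, is shortened when the walk revisits it, and becomes a link once `V` is
    -- reached.
    link-or-inner : ∀ {v u} → Star (AdjOutside G ⁅ z ⁆) v u → v ≢ z → u ∈ U →
      Link z U V ⊎ ∃₂ λ w (q : Star Adj v w) → w ∈ U × Unique (verts q) ×
        (∀ {k} → k ∈ sources q → k ∉ U) × (∀ {k} → k ∈ verts q → k ∉ V) × z ∉ verts q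
    link-or-inner {v} ε v≢z u∈U with v ∈? V
    ... | yes v∈V = inj₁ record
      { path = ε ; start∈ = v∈V ; end∈ = u∈U ; unique = [] ∷ []
      ; sources∉ = λ () ; targets∉ = λ () ; z∉ = λ { (here refl) → v≢z refl } }
    ... | no  v∉V = inj₂ (v , ε , u∈U , [] ∷ [] , (λ ()) , (λ { (here refl) → v∉V })
      , λ { (here refl) → v≢z refl })
    link-or-inner {v} ((_ , w∉ , a) ◅ p) v≢z u∈U with link-or-inner p (x∉⁅y⁆⇒x≢y w∉) u∈U
    ... | inj₁ l = inj₁ l
    ... | inj₂ (w , q , w∈U , uniq , s∉ , q∉ , z∉) with v ∈? V | v ∈? U | v ∈? verts q
    ...   | yes v∈V | yes v∈U | _ = inj₁ record
      { path = ε ; start∈ = v∈V ; end∈ = v∈U ; unique = [] ∷ []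
      ; sources∉ = λ () ; targets∉ = λ () ; z∉ = λ { (here refl) → v≢z refl } }
    ...   | yes v∈V | no v∉U | _ = inj₁ record
      { path = a ◅ q ; start∈ = v∈V ; end∈ = w∈U
      ; unique = All.tabulate (λ i → λ { refl → q∉ i v∈V }) ∷ uniq
      ; sources∉ = λ { (here refl) → v∉U ; (there i) → s∉ i }
      ; targets∉ = q∉
      ; z∉ = λ { (here refl) → v≢z refl ; (there i) → z∉ i } }
    ...   | no v∉V | yes v∈U | _ = inj₂ (v , ε , v∈U , [] ∷ [] , (λ ())
      , (λ { (here refl) → v∉V }) , λ { (here refl) → v≢z refl })
    ...   | no v∉V | no v∉U | yes v∈q with r , ur , vs , ss , _ ← suffix-∈ q uniq v∈q =
      inj₂ (w , r , w∈U , ur , s∉ ∘ ss , q∉ ∘ vs , z∉ ∘ vs)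
    ...   | no v∉V | no v∉U | no v∉q = inj₂ (w , a ◅ q , w∈U , ¬Any⇒All¬ _ v∉q ∷ uniq
      , (λ { (here refl) → v∉U ; (there i) → s∉ i })
      , (λ { (here refl) → v∉V ; (there i) → q∉ i })
      , λ { (here refl) → v≢z refl ; (there i) → z∉ i })

  -- The proof uses 2-connectedness only in this form, with one vertex deleted.
  avoiding : TwoConnected G → ∀ {z u v} → u ≢ z → v ≢ z → Star (AdjOutside G ⁅ z ⁆) u v
  avoiding (κ , ((_ , conn) , _) , 2≤κ) {z} u≢z v≢z =
    conn ⁅ z ⁆ (subst (_< κ) (sym (∣⁅x⁆∣≡1 z)) 2≤κ) _ _ (x≢y⇒x∉⁅y⁆ u≢z) (x≢y⇒x∉⁅y⁆ v≢z)

  link : TwoConnected G → ∀ {z U V v u} → v ∈ V → v ≢ z → u ∈ U → u ≢ z → Link z U V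
  link conn v∈V v≢z u∈U u≢z with link-or-inner (avoiding conn v≢z u≢z) v≢z u∈U
  ... | inj₁ l = l
  -- The inner path would start at `v`, which lies in `V`.
  ... | inj₂ (_ , _ , _ , _ , _ , ∉V , _) = ⊥-elim (∉V (here refl) v∈V)

  -- Two disjoint branches swept along the path.

  -- The path runs from the head back to `A`, so that growing the branch prepends an edge. The head
  -- itself may lie in `rest`.
  record Branch (A rest : List (Fin n)) (h : Fin n) : Set where
    field
      {root}   : Fin n
      path     : Star Adj h root
      unique   : Unique (verts path)
      root∈    : root ∈ A
      sources∉ : ∀ {k} → k ∈ sources path → k ∉ A
      targets∉ : ∀ {k} → k ∈ targets path → k ∉ rest

  open Branch

  -- Two disjoint paths rooted in A, one of them at s; the first has reached y, and the
  -- second has jumped ahead into rest.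
  record Fork (s : Fin n) (A : List (Fin n)) (y : Fin n) (rest : List (Fin n)) : Set where
    field
      b₁       : Branch A rest y
      {h}      : Fin n
      h∈       : h ∈ rest
      b₂       : Branch A rest h
      disjoint : Disjoint (verts (path b₁)) (verts (path b₂))
      s-root   : s ≡ root b₁ ⊎ s ≡ root b₂

  module _ {A rest : List (Fin n)} {z : Fin n} where

    drop-target : ∀ {h} → Branch A (z ∷ rest) h → Branch A rest h
    drop-target b = record
      { path = path b ; unique = unique b ; root∈ = root∈ b ; sources∉ = sources∉ b
      ; targets∉ = λ i → targets∉ b i ∘ there }

    extend : ∀ {y} → Branch A (z ∷ rest) y → Adj y z → Unique (y ∷ z ∷ rest) → z ∉ A →
             Branch A rest z
    extend b a ((y≢z ∷ y≢) ∷ _) z∉A = record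
      { path     = symm a ◅ path b
      ; unique   = All.tabulate (λ { (here refl) refl → y≢z refl
                                   ; (there i)   refl → targets∉ b i (here refl) })
                   ∷ unique b
      ; root∈    = root∈ b
      ; sources∉ = λ { (here refl) → z∉A ; (there i) → sources∉ b i }
      ; targets∉ = λ { (here refl) i → All.lookup y≢ i refl
                     ; (there i)   → targets∉ b i ∘ there } }

  -- The link avoids `s` and aims at `A` without `s`, so it is disjoint from the trivial branch at
  -- `s`; `a` provides a target.
  start-fork : TwoConnected G → ∀ {s A rest a v} → s ∈ A → a ∈ A → a ≢ s → v ∈ rest →
               Disjoint A rest → Fork s A s rest
  start-fork conn {s} {A} {rest} s∈ a∈ a≢s v∈ dis = record
    { b₁ = record { path = ε ; unique = [] ∷ [] ; root∈ = s∈ ; sources∉ = λ () ; targets∉ = λ () }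
    ; h∈ = Link.start∈ l
    ; b₂ = record
      { path = Link.path l
      ; unique = Link.unique l
      ; root∈ = proj₁ (∈-filter⁻ ≢s? {xs = A} (Link.end∈ l))
      -- The sources avoid the rest of `A` as sources of a link, and `s` as the deleted vertex.
      ; sources∉ = λ i i∈A → Link.sources∉ l i (∈-filter⁺ ≢s? i∈A λ { refl → Link.z∉ l (source⇒vert (Link.path l) i) })
      ; targets∉ = Link.targets∉ l }
    ; disjoint = λ { (here refl , i) → Link.z∉ l i }
    ; s-root = inj₁ refl }
    where
    ≢s? : Decidable (_≢ s)
    ≢s? k = ¬? (k ≟ s)
    l : Link s (filter ≢s? A) rest
    l = link conn v∈ (λ { refl → dis (s∈ , v∈) }) (∈-filter⁺ ≢s? a∈ a≢s) a≢s

  -- If the second branch has jumped beyond `z`, the first one takes the edge to `z`. If its head is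
  -- `z`, a link avoiding `z` supplies a new jump into `rest`, and the place where it ends decides
  -- which branch goes on to `z`.
  advance : TwoConnected G → ∀ {s A y z rest v} → s ∈ A → v ∈ rest → Adj y z →
            Unique (y ∷ z ∷ rest) → Disjoint A (z ∷ rest) →
            Fork s A y (z ∷ rest) → Fork s A z rest
  advance conn {s} {A} {y} {z} {rest} s∈ v∈ y~z uniq@((y≢z ∷ y≢) ∷ (z≢ ∷ _)) dis
    record { b₁ = b₁ ; h∈ = there h∈ ; b₂ = b₂ ; disjoint = disjoint ; s-root = s-root } = record
      { b₁ = extend b₁ y~z uniq (λ i → dis (i , here refl))
      ; h∈ = h∈
      ; b₂ = drop-target b₂
      ; disjoint = λ { (here refl , here refl) → All.lookup z≢ h∈ refl
                     ; (here refl , there i) → targets∉ b₂ i (here refl)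
                     ; (there i , j) → disjoint (i , j) }
      ; s-root = s-root }
  advance conn {s} {A} {y} {z} {rest} s∈ v∈ y~z uniq@((y≢z ∷ y≢) ∷ (z≢ ∷ _)) dis
    record { b₁ = b₁ ; h∈ = here refl ; b₂ = b₂ ; disjoint = disjoint ; s-root = s-root } = cases
    where
    p₁ = path b₁
    p₂ = path b₂
    -- Both branches and `A`, without `z`, the head of `p₂`.
    U : List (Fin n)
    U = verts p₁ ++ (targets p₂ ++ A)

    reaching : Link z U rest
    reaching = link conn v∈ (λ { refl → All.lookup z≢ v∈ refl }) (here refl) y≢z
    open Link reaching using (start; end; start∈; end∈; z∉)
      renaming (path to l; unique to ul; sources∉ to s∉; targets∉ to t∉)

    b₁⁺ : Branch A rest z
    b₁⁺ = extend b₁ y~z uniq (λ i → dis (i , here refl))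

    A⊆U : A ⊆ U
    A⊆U = ∈-++⁺ʳ (verts p₁) ∘ ∈-++⁺ʳ (targets p₂)

    -- The link meets `U` in `end` only, so a path inside `U` can be appended without repetition.
    reroute : ∀ {r} (q : Star Adj end r) → Unique (verts q) → verts q ⊆ U → r ∈ A →
              (∀ {k} → k ∈ sources q → k ∉ A) → (∀ {k} → k ∈ targets q → k ∉ rest) →
              Branch A rest start
    reroute q uq q⊆ r∈ q∉ t∉′ = record
      { path     = l ◅◅ q
      ; unique   = subst Unique (sym (verts-◅◅ l q))
          (Unique.++⁺ (proj₁ (unique-sources l ul)) uq (λ (i , j) → s∉ i (q⊆ j)))
      ; root∈    = r∈
      ; sources∉ = λ {k} i → [ (λ j → s∉ j ∘ A⊆U) , q∉ ]′
          (∈-++⁻ (sources l) (subst (k ∈_) (sources-◅◅ l q) i))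
      ; targets∉ = λ {k} i → [ t∉ , t∉′ ]′
          (∈-++⁻ (targets l) (subst (k ∈_) (targets-◅◅ l q) i)) }

    apart : ∀ xs {r} (q : Star Adj end r) → Disjoint xs (sources l) → Disjoint xs (verts q) →
            Disjoint xs (verts (l ◅◅ q))
    apart _ q dl dq {k} (i , j) = [ (λ j′ → dl (i , j′)) , (λ j′ → dq (i , j′)) ]′
      (∈-++⁻ (sources l) (subst (k ∈_) (verts-◅◅ l q) j))

    b₁⁺-apart : Disjoint (verts (path b₁⁺)) (sources l)
    b₁⁺-apart (here refl , j) = z∉ (source⇒vert l j)
    b₁⁺-apart (there i   , j) = s∉ j (∈-++⁺ˡ i)

    b₂-apart : Disjoint (verts p₂) (sources l)
    b₂-apart (here refl , j) = z∉ (source⇒vert l j)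
    b₂-apart (there i   , j) = s∉ j (∈-++⁺ʳ (verts p₁) (∈-++⁺ˡ i))

    cases : Fork s A z rest
    cases with end ∈? verts p₁ | end ∈? targets p₂
    -- The link lands on the first branch: the second, already at `z`, takes over its role, and the
    -- two roots swap places.
    ... | yes w∈ | _ with q , uq , vs , ss , ts ← suffix-∈ p₁ (unique b₁) w∈ = record
      { b₁ = drop-target b₂
      ; h∈ = start∈
      ; b₂ = reroute q uq (∈-++⁺ˡ ∘ vs) (root∈ b₁) (sources∉ b₁ ∘ ss)
               (λ i → targets∉ b₁ (ts i) ∘ there)
      ; disjoint = apart (verts p₂) q b₂-apart λ (i , j) → disjoint (vs j , i)
      ; s-root = swap s-root }
    -- The link lands on the second branch, so the first one proceeds to `z`.
    ... | no _ | yes w∈ with q , uq , vs , ss , ts ← suffix-targets p₂ (unique b₂) w∈ = record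
      { b₁ = b₁⁺
      ; h∈ = start∈
      ; b₂ = reroute q uq (∈-++⁺ʳ (verts p₁) ∘ ∈-++⁺ˡ ∘ vs) (root∈ b₂) (sources∉ b₂ ∘ ss)
               (λ i → targets∉ b₂ (ts i) ∘ there)
      ; disjoint = apart (verts (path b₁⁺)) q b₁⁺-apart λ where
          (here refl , j) → Unique.Unique[x∷xs]⇒x∉xs (unique b₂) (vs j)
          (there i   , j) → disjoint (i , there (vs j))
      ; s-root = s-root }
    ... | no w∉₁ | no w∉₂ = cases-A s-root
      where
      b₃ : Branch A rest start
      b₃ = reroute ε ([] ∷ []) (λ { (here refl) → end∈ })
        ([ ⊥-elim ∘ w∉₁ , [ ⊥-elim ∘ w∉₂ , id ]′ ∘ ∈-++⁻ (targets p₂) ]′ (∈-++⁻ (verts p₁) end∈))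
        (λ ()) (λ ())

      -- The link lands in `A` off both branches and is a branch by itself; the old branch rooted at
      -- `s` must be the one that is kept.
      cases-A : s ≡ root b₁ ⊎ s ≡ root b₂ → Fork s A z rest
      cases-A (inj₁ s≡) = record
        { b₁ = b₁⁺
        ; h∈ = start∈
        ; b₂ = b₃
        ; disjoint = apart (verts (path b₁⁺)) ε b₁⁺-apart λ where
            (here k≡z , here k≡w) → z∉ (subst (_∈ verts l) (trans (sym k≡w) k≡z) (last∈verts l))
            (there i   , here k≡w) → w∉₁ (subst (_∈ verts p₁) k≡w i)
        ; s-root = inj₁ s≡ }
      cases-A (inj₂ s≡) = record
        { b₁ = drop-target b₂
        ; h∈ = start∈
        ; b₂ = b₃
        ; disjoint = apart (verts p₂) ε b₂-apart λ where
            (here k≡z , here k≡w) → z∉ (subst (_∈ verts l) (trans (sym k≡w) k≡z) (last∈verts l))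
            (there i   , here k≡w) → w∉₂ (subst (_∈ targets p₂) k≡w i)
        ; s-root = inj₁ s≡ }

  -- The unswept part shrinks to `rest`, so in the end the second branch has its head past `t`.
  sweep : TwoConnected G → ∀ {s A rest v y t} (p : Star Adj y t) → s ∈ A → v ∈ rest →
          Unique (verts p ++ rest) → Disjoint A (targets p ++ rest) →
          Fork s A y (targets p ++ rest) → Fork s A t rest
  sweep conn ε s∈ v∈ uniq dis f = f
  sweep conn (e ◅ p) s∈ v∈ uniq@(_ ∷ uniq′) dis f =
    sweep conn p s∈ v∈ uniq′ (λ (i , j) → dis (i , there j))
      (advance conn s∈ (∈-++⁺ʳ (targets p) v∈) e uniq dis f)

  -- Rerouting inside the end parts.

  -- Walk back from s to the first neighbour r of x after a, jump to x, and walk on to a: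
  -- only vertices strictly between a and r are lost, and none of them is adjacent to x.
  reroot : ∀ {x s a} (p : Star Adj x s) → Unique (verts p) → Adj x s → a ∈ verts p → a ≢ s →
           (∀ {w} → Adj x w → w ∈ verts p) →
           ∃ λ (q : Star Adj s a) → Unique (verts q) × verts q ⊆ verts p ×
             degree G x ≤ length (targets q)
  reroot {x} {s} {a} p uniq x~s a∈ a≢s Nx⊆ with split-∈ p a∈
  ... | p₁ , ε , refl = ⊥-elim (a≢s refl)
  ... | p₁ , e ◅ p₂ , refl
    with r , r₁ , r₂ , refl , x~r , free ← split-first (adj? x) p₂ (lose (last∈verts p₂) x~s) =
    q , unique-↭ (↭-sym perm) (Unique.++⁺ u₂ u₁ (λ (i , j) → d₁ (j , ∈-++⁺ʳ (sources r₁) i)))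
      -- Besides its neighbours, `x` itself lies on `q`, as the start of `p₁`; this pays for
      -- counting `targets q` in place of `verts q`.
      , sub , s≤s⁻¹ (degree-< {ys = verts q} (into (inj₂ (here refl))) nbr)
    where
    q : Star Adj s a
    q = rev symm r₂ ◅◅ (symm x~r ◅ p₁)

    perm : verts q ↭ verts r₂ ++ verts p₁
    perm = ↭-trans (↭-reflexive (verts-◅◅-◅ (rev symm r₂) (symm x~r) p₁))
             (++⁺ʳ (verts p₁) (verts-rev symm r₂))

    verts≡ : verts (p₁ ◅◅ (e ◅ (r₁ ◅◅ r₂))) ≡ verts p₁ ++ (sources r₁ ++ verts r₂)
    verts≡ = trans (verts-◅◅-◅ p₁ e (r₁ ◅◅ r₂)) (cong (verts p₁ ++_) (verts-◅◅ r₁ r₂))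

    parts : Unique (verts p₁) × Unique (sources r₁ ++ verts r₂) ×
            Disjoint (verts p₁) (sources r₁ ++ verts r₂)
    parts = unique-++⁻ (verts p₁) (subst Unique verts≡ uniq)

    u₁ : Unique (verts p₁)
    u₁ = proj₁ parts

    d₁ : Disjoint (verts p₁) (sources r₁ ++ verts r₂)
    d₁ = proj₂ (proj₂ parts)

    u₂ : Unique (verts r₂)
    u₂ = proj₁ (proj₂ (unique-++⁻ (sources r₁) (proj₁ (proj₂ parts))))

    into : ∀ {w} → w ∈ verts r₂ ⊎ w ∈ verts p₁ → w ∈ verts q
    into i = ∈-resp-↭ (↭-sym perm) ([ ∈-++⁺ˡ , ∈-++⁺ʳ (verts r₂) ]′ i)

    sub : verts q ⊆ verts (p₁ ◅◅ (e ◅ (r₁ ◅◅ r₂)))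
    sub {w} i = subst (w ∈_) (sym verts≡)
      ([ ∈-++⁺ʳ (verts p₁) ∘ ∈-++⁺ʳ (sources r₁) , ∈-++⁺ˡ ]′
        (∈-++⁻ (verts r₂) (∈-resp-↭ perm i)))

    nbr : ∀ {w} → Adj x w → w ∈ verts q
    nbr {w} a with ∈-++⁻ (verts p₁) (subst (w ∈_) verts≡ (Nx⊆ a))
    ... | inj₁ i = into (inj₂ i)
    ... | inj₂ i with ∈-++⁻ (sources r₁) i
    ...   | inj₁ j = contradiction a (All.lookup free j)
    ...   | inj₂ j = into (inj₁ j)

  -- `reroot` starts at `s`, so its path is reversed when `s` is the second root.
  reroot-between : ∀ {x s r₁ r₂} (p : Star Adj x s) → Unique (verts p) → Adj x s →
    (∀ {w} → Adj x w → w ∈ verts p) →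
    r₁ ∈ verts p → r₂ ∈ verts p → r₁ ≢ r₂ → s ≡ r₁ ⊎ s ≡ r₂ →
    ∃ λ (q : Star Adj r₁ r₂) → Unique (verts q) × verts q ⊆ verts p ×
      degree G x ≤ length (sources q)
  reroot-between {x} p uniq x~s Nx⊆ _ r₂∈ r₁≢r₂ (inj₁ refl)
    with q , uq , q⊆ , long ← reroot p uniq x~s r₂∈ (r₁≢r₂ ∘ sym) Nx⊆ =
    q , uq , q⊆ , subst (degree G x ≤_) (length-targets q) long
  reroot-between {x} p uniq x~s Nx⊆ r₁∈ _ r₁≢r₂ (inj₂ refl)
    with q , uq , q⊆ , long ← reroot p uniq x~s r₁∈ r₁≢r₂ Nx⊆ =
    rev symm q , unique-↭ (↭-sym (verts-rev symm q)) uq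
      , q⊆ ∘ ∈-resp-↭ (verts-rev symm q)
      , subst (degree G x ≤_) (sym (↭-length (sources-rev symm q))) long

  -- The cycle when no neighbour of y precedes a neighbour of x.

  module Separated (conn : TwoConnected G) {x s t y : Fin n}
    (pA : Star Adj x s) (pM : Star Adj s t) (pB : Star Adj t y)
    (uniq : Unique (verts (pA ◅◅ (pM ◅◅ pB)))) (x~s : Adj x s) (y~t : Adj y t)
    (Nx⊆ : ∀ {w} → Adj x w → w ∈ verts pA) (Ny⊆ : ∀ {w} → Adj y w → w ∈ verts pB) where

    private
      verts≡ : verts (pA ◅◅ (pM ◅◅ pB)) ≡ verts pA ++ (targets pM ++ targets pB)
      verts≡ = cong (x ∷_)
        (trans (targets-◅◅ pA (pM ◅◅ pB)) (cong (targets pA ++_) (targets-◅◅ pM pB)))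

      uA : Unique (verts pA)
      uA = proj₁ (unique-++⁻ (verts pA) (subst Unique verts≡ uniq))

      disA : Disjoint (verts pA) (targets pM ++ targets pB)
      disA = proj₂ (proj₂ (unique-++⁻ (verts pA) (subst Unique verts≡ uniq)))

      uMB : Unique (verts (pM ◅◅ pB))
      uMB = proj₁ (proj₂ (unique-++⁻ (sources pA) (subst Unique (verts-◅◅ pA (pM ◅◅ pB)) uniq)))

      uB : Unique (verts pB)
      uB = proj₁ (proj₂ (unique-++⁻ (sources pM) (subst Unique (verts-◅◅ pM pB) uMB)))

      y∈ : y ∈ targets pB
      y∈ with last∈verts pB
      ... | here refl = ⊥-elim (irrefl refl y~t)
      ... | there i   = i

      fork : Fork s (verts pA) t (targets pB)
      -- The vertex of `pA` other than `s` is `x`. If `pM` is empty, `s` is `t` and the initial fork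
      -- is already the required one.
      fork = sweep conn pM (last∈verts pA) y∈
        (subst Unique (cong (s ∷_) (targets-◅◅ pM pB)) uMB) disA
        (start-fork conn (last∈verts pA) (here refl) (λ { refl → irrefl refl x~s })
          (∈-++⁺ʳ (targets pM) y∈) disA)

      open Fork fork

      p₁ : Star Adj t (root b₁)
      p₁ = path b₁

      p₂ : Star Adj h (root b₂)
      p₂ = path b₂

      roots≢ : root b₁ ≢ root b₂
      roots≢ eq = disjoint (last∈verts p₁ , subst (_∈ verts p₂) (sym eq) (last∈verts p₂))

      A-part : ∃ λ (q : Star Adj (root b₁) (root b₂)) → Unique (verts q) ×
               verts q ⊆ verts pA × degree G x ≤ length (sources q)
      A-part = reroot-between pA uA x~s Nx⊆ (root∈ b₁) (root∈ b₂) roots≢ s-root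

      -- Reversed, `pB` runs from `y` to its neighbour `t`. The first branch always has head `t`,
      -- which fixes the direction.
      B-part : ∃ λ (q : Star Adj t h) → Unique (verts q) ×
               verts q ⊆ verts pB × degree G y ≤ length (targets q)
      B-part
        with q , uq , q⊆ , long ← reroot (rev symm pB) (unique-↭ (↭-sym (verts-rev symm pB)) uB)
               y~t (∈-resp-↭ (↭-sym (verts-rev symm pB)) (there h∈))
               (λ h≡t → Unique.Unique[x∷xs]⇒x∉xs uB (subst (_∈ targets pB) h≡t h∈))
               (∈-resp-↭ (↭-sym (verts-rev symm pB)) ∘ Ny⊆) =
        q , uq , ∈-resp-↭ (verts-rev symm pB) ∘ q⊆ , long

    -- From `t` down the first branch, along `qA` to the other root, up the second branch to `h`,
    -- and along `qB` reversed to `t`. The degrees are supplied by `qA` and `qB` alone.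
    long-cycle : ∃ λ (p : Star Adj t t) → Unique (sources p) ×
                 degree G x + degree G y ≤ length (sources p)
    long-cycle with qA , uqA , qA⊆ , longA ← A-part | qB , uqB@(_ ∷ uqB′) , qB⊆ , longB ← B-part =
      cycle , unique-↭ (↭-sym perm) uL , (begin
        degree G x + degree G y                            ≤⟨ +-mono-≤ longA longB ⟩
        length (sources qA) + length (targets qB)          ≤⟨ +-monoʳ-≤ (length (sources qA))
                                                                (m≤n+m _ (length (targets p₂))) ⟩
        length (sources qA) +
          (length (targets p₂) + length (targets qB))      ≤⟨ m≤n+m _ (length (sources p₁)) ⟩
        length (sources p₁) + (length (sources qA) +
          (length (targets p₂) + length (targets qB)))     ≡⟨ length-L ⟨
        length L                                           ≡⟨ ↭-length perm ⟨
        length (sources cycle)                             ∎)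
      where
      open ≤-Reasoning

      cycle : Star Adj t t
      cycle = p₁ ◅◅ (qA ◅◅ (rev symm p₂ ◅◅ rev symm qB))

      -- Up to order, a reversed piece has the targets of the original as its sources.
      L : List (Fin n)
      L = sources p₁ ++ (sources qA ++ (targets p₂ ++ targets qB))

      length-L : length L ≡ length (sources p₁) + (length (sources qA) +
                   (length (targets p₂) + length (targets qB)))
      length-L = trans (length-++ (sources p₁)) (cong (length (sources p₁) +_)
        (trans (length-++ (sources qA)) (cong (length (sources qA) +_) (length-++ (targets p₂)))))

      perm : sources cycle ↭ L
      perm = ↭-trans (↭-reflexive (sources-◅◅ p₁ _)) (++⁺ˡ (sources p₁)
        (↭-trans (↭-reflexive (sources-◅◅ qA _)) (++⁺ˡ (sources qA)
          (↭-trans (↭-reflexive (sources-◅◅ (rev symm p₂) _))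
            (++⁺ (sources-rev symm p₂) (sources-rev symm qB))))))

      qB-targets : targets qB ⊆ targets pB
      qB-targets i with qB⊆ (there i)
      ... | here refl = ⊥-elim (Unique.Unique[x∷xs]⇒x∉xs uqB i)
      ... | there j   = j

      A∩B : ∀ {k} → k ∈ verts pA → k ∉ targets qB
      A∩B i j = disA (i , ∈-++⁺ʳ (targets pM) (qB-targets j))

      p₁∩B : Disjoint (sources p₁) (targets qB)
      p₁∩B (i , j) with source⇒vert p₁ i
      ... | here refl = Unique.Unique[x∷xs]⇒x∉xs uqB j
      ... | there k   = targets∉ b₁ k (qB-targets j)

      A∩p₂ : Disjoint (sources qA) (targets p₂)
      A∩p₂ (i , j) with vert⇒source p₂ (there j)
      ... | inj₁ k    = sources∉ b₂ k (qA⊆ (source⇒vert qA i))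
      -- The root of the second branch is the end of `qA`, hence not among its sources.
      ... | inj₂ refl = proj₂ (unique-sources qA uqA) i

      ++-disjoint : {xs ys zs : List (Fin n)} → Disjoint xs ys → Disjoint xs zs →
                    Disjoint xs (ys ++ zs)
      ++-disjoint {ys = ys} dy dz (i , j) =
        [ (λ k → dy (i , k)) , (λ k → dz (i , k)) ]′ (∈-++⁻ ys j)

      uL : Unique L
      uL = Unique.++⁺ (proj₁ (unique-sources p₁ (unique b₁)))
        (Unique.++⁺ (proj₁ (unique-sources qA uqA))
          (Unique.++⁺ (proj₁ (proj₂ (unique-++⁻ [ h ] (unique b₂)))) uqB′
            (λ (i , j) → targets∉ b₂ i (qB-targets j)))
          (++-disjoint A∩p₂ (λ (i , j) → A∩B (qA⊆ (source⇒vert qA i)) j)))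
        (++-disjoint (λ (i , j) → sources∉ b₁ i (qA⊆ (source⇒vert qA j)))
          (++-disjoint (λ (i , j) → disjoint (source⇒vert p₁ i , there j)) p₁∩B))

-- Assembling the bound.

theorem3 : ∀ {n : ℕ} (G : Graph n) → TwoConnected G →
    ∀ (c p : ℕ) → IsLongestCycleOrder G c → IsLongestPathOrder G p →
    c ≥ p ⊓ (d G (δ G) + d G (suc (δ G)))
theorem3 {n} G conn c m
  ((_ , (3≤ , _) , c≡) , cycle≤c) (((x₀ ∷ xs) , (uniq₀ , linked) , m≡) , path≤m)
  with _ , p₀ , verts≡ ← linked⇒walk G linked
  with _ , _ , p , lp , D≤ ←
         -- With fuel `n + n` the initial bound holds trivially.
         LongestPath.heavyLongest G m path≤m (n + n) p₀
           (subst Unique (sym verts≡) uniq₀ , trans (cong length verts≡) m≡)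
           (m≤m+n _ _)
  = bound p lp D≤
  where
  open Graph G
  open LongestPath G m path≤m
  open LongestCycle G c (subst (3 ≤_) c≡ 3≤) cycle≤c

  D : ℕ
  D = d G (δ G) + d G (suc (δ G))

  long-path : ∀ {x y} {p : Star Adj x y} → Longest p → length (verts p) ≤ c → m ⊓ D ≤ c
  long-path (_ , len) l≤c = ≤-trans (m⊓n≤m m D) (subst (_≤ c) len l≤c)

  heavy-cycle : ∀ {x y} → D ≤ degree G x + degree G y → degree G x + degree G y ≤ c → m ⊓ D ≤ c
  heavy-cycle D≤ l≤c = ≤-trans (m⊓n≤n m D) (≤-trans D≤ l≤c)

  -- The negative hypotheses confine the neighbours of `x` to `pA` and those of `y` to `pB`.
  separated≤c : ∀ {x s t y} (pA : Star Adj x s) (pM : Star Adj s t) (pB : Star Adj t y) →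
    Longest ((pA ◅◅ pM) ◅◅ pB) → Adj x s → Adj y t →
    All (¬_ ∘ Adj y) (sources (pA ◅◅ pM)) → All (¬_ ∘ Adj x) (targets pM) →
    All (¬_ ∘ Adj x) (targets pB) → degree G x + degree G y ≤ c
  separated≤c {x} {s} {t} {y} pA pM pB lp x~s y~t ¬y ¬xM ¬xB =
    let p , up , long = Separated.long-cycle G conn pA pM pB
          (subst (Unique ∘ verts) (◅◅-assoc pA pM pB) (proj₁ lp)) x~s y~t Nx⊆ Ny⊆
    in ≤-trans long (closed-walk≤c p up)
    where
    Nx⊆ : ∀ {w} → Adj x w → w ∈ verts pA
    Nx⊆ a with verts-++⁻ (pA ◅◅ pM) pB (neighbour∈longest _ lp a)
    ... | inj₂ i = contradiction a (All.lookup ¬xB i)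
    ... | inj₁ i with verts-++⁻ pA pM i
    ...   | inj₁ j = j
    ...   | inj₂ j = contradiction a (All.lookup ¬xM j)

    Ny⊆ : ∀ {w} → Adj y w → w ∈ verts pB
    Ny⊆ {w} a with ∈-++⁻ (sources (pA ◅◅ pM))
      (subst (w ∈_) (verts-◅◅ (pA ◅◅ pM) pB) (neighbour∈longest′ _ lp a))
    ... | inj₁ i = contradiction a (All.lookup ¬y i)
    ... | inj₂ i = i

  -- The neighbours `j` and `k` guarantee that the searches along the path succeed.
  bound′ : ∀ {x y j k} (p : Star Adj x y) → Longest p → D ≤ degree G x + degree G y →
           Adj x j → Adj y k → m ⊓ D ≤ c
  bound′ {x} {y} p lp D≤ x~j y~k
    with crossing-or-separated (adj? y) (adj? x) p (lose (neighbour∈longest′ p lp y~k) y~k)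
  ... | inj₁ cr = [ long-path lp , heavy-cycle D≤ ]′
    (crossing≤c (proj₁ lp) (neighbour∈longest p lp) (neighbour∈longest′ p lp) cr)
  ... | inj₂ (t , p₁ , p₂ , refl , y~t , ¬y , ¬x) with verts-++⁻ p₁ p₂ (neighbour∈longest _ lp x~j)
  ...   | inj₂ i = contradiction x~j (All.lookup ¬x i)
  ...   | inj₁ i with s , pA , pM , refl , x~s , ¬x′ ← split-last (adj? x) p₁ (lose i x~j) =
    heavy-cycle D≤ (separated≤c pA pM p₂ lp x~s y~t ¬y ¬x′ ¬x)

  bound : ∀ {x y} (p : Star Adj x y) → Longest p → D ≤ degree G x + degree G y → m ⊓ D ≤ c
  -- A longest path with a single vertex has order 1, which is below `c`.
  bound ε lp@(_ , refl) _ = long-path lp (≤-trans (s≤s z≤n) (subst (3 ≤_) c≡ 3≤))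
  bound p@(e ◅ p′) lp D≤ with _ , a ← last-adj G e p′ = bound′ p lp D≤ e a
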